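{- Let $H$ be a finite simple graph with $n=|V(H)|\ge 1$ vertices, chromatic number $\chi=\chi(H)$, and let $m'=m'(H)$ denote the number of non-edges of $H$. Then $$\left\lceil \frac{n}{\chi} \right\rceil \left( n - \frac{\chi}{2}\left\lceil\frac{n}{\chi}-1\right\rceil\right) \leq \rho(H) \leq n+m'.$$
   Context: All graphs are finite and simple. A coloring of a graph means a proper vertex coloring. An induced subgraph is rainbow if all its vertices receive pairwise different colors. For a graph $H$, $\rho(H)$ is the least number $m$ such that there exists a graph $G$ on $m$ vertices with the property that every proper vertex coloring of $G$ contains a rainbow induced subgraph isomorphic to $H$. A non-edge of $H$ is an unordered pair of distinct non-adjacent vertices of $H$. -}

module Defs where

open import Data.Bool using (Bool; true; false)
open import Data.Bool.Properties using () renaming (_≟_ to _≟ᵇ_)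
open import Data.Fin using (Fin; fromℕ<; _<?_)
open import Data.Fin.Properties using (nonZeroIndex)
open import Data.Integer using (+_)
open import Data.List using (List; length; filter; allFin; cartesianProduct)
open import Data.Nat using (ℕ; _≤_; NonZero)
open import Data.Product using (Σ-syntax; _×_; _,_)
open import Data.Rational.Unnormalised using (ℚᵘ; _/_; _*_; _-_; 1ℚᵘ; ceiling)
open import Function.Definitions using (Injective)
open import Relation.Binary.PropositionalEquality using (_≡_; _≢_)
open import Relation.Nullary.Decidable using (_×-dec_)

-- A finite simple graph with vertex set Fin n, given by its adjacency matrix.
record Graph (n : ℕ) : Set where
  field
    adj    : Fin n → Fin n → Bool
    symm   : ∀ u v → adj u v ≡ adj v u
    irrefl : ∀ u → adj u u ≡ false

open Graph public

Proper : ∀ {n} {C : Set} → Graph n → (Fin n → C) → Set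
Proper G c = ∀ u v → adj G u v ≡ true → c u ≢ c v

Colorable : ∀ {n} → Graph n → ℕ → Set
Colorable {n} G k = Σ[ c ∈ (Fin n → Fin k) ] Proper G c

IsLeast : (ℕ → Set) → ℕ → Set
IsLeast P m = P m × (∀ k → P k → m ≤ k)

IsChromaticNumber : ∀ {n} → Graph n → ℕ → Set
IsChromaticNumber H = IsLeast (Colorable H)

-- f identifies H with the subgraph of G induced on the image of f.
IsInducedCopy : ∀ {n m} → Graph n → Graph m → (Fin n → Fin m) → Set
IsInducedCopy H G f =
  Injective _≡_ _≡_ f × (∀ u v → adj G (f u) (f v) ≡ adj H u v)

HasRainbowCopy : ∀ {n m} {C : Set} → Graph n → Graph m → (Fin m → C) → Set
HasRainbowCopy {n} {m} H G c =
  Σ[ f ∈ (Fin n → Fin m) ]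
    IsInducedCopy H G f × Injective _≡_ _≡_ (λ u → c (f u))

-- Colors are drawn from ℕ, so the number of colors is not bounded in advance.
ForcesRainbow : ∀ {n m} → Graph n → Graph m → Set
ForcesRainbow {m = m} H G =
  (c : Fin m → ℕ) → Proper G c → HasRainbowCopy H G c

Isρ : ∀ {n} → Graph n → ℕ → Set
Isρ H = IsLeast (λ m → Σ[ G ∈ Graph m ] ForcesRainbow H G)

-- Each unordered pair {u , v} of distinct vertices is listed once, with u < v.
nonEdges : ∀ {n} → Graph n → List (Fin n × Fin n)
nonEdges {n} H =
  filter (λ (u , v) → (u <? v) ×-dec (adj H u v ≟ᵇ false))
         (cartesianProduct (allFin n) (allFin n))

χ-nonZero : ∀ {n} (H : Graph n) {χ} → 1 ≤ n → IsChromaticNumber H χ → NonZero χ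
χ-nonZero H 1≤n ((c , _) , _) = nonZeroIndex (c (fromℕ< 1≤n))

lowerBound : (n χ : ℕ) .{{_ : NonZero χ}} → ℚᵘ
lowerBound n χ =
  (ceiling (+ n / χ) / 1) *
  (+ n / 1 - (+ χ / 2) * (ceiling (+ n / χ - 1ℚᵘ) / 1))

{-# OPTIONS --safe #-}

-- Upper bound: replace each vertex i of H by a clique with one vertex more than i has
-- earlier non-neighbours. In a proper colouring a rainbow copy of H is found greedily:
-- the chosen copies of the earlier neighbours of i are adjacent to every copy of i, and
-- the earlier non-neighbours are too few to block all copies of i.
--
-- Lower bound: if G forces a rainbow copy of H and S is a set of vertices that some proper
-- colouring of G colours with i χ colours, then a rainbow copy meets S in at most i χ
-- vertices. Adding the copy to S gains n − i χ vertices, and the new set needs only χ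
-- further colours. Hence |V(G)| ≥ Σ_{i<k} (n − i χ) for every k, in particular for
-- k = ⌈n/χ⌉.
module Submission where

open import Defs
open import Data.Bool using (Bool; true; false; not; _∧_; _∨_)
open import Data.Bool.Properties using (∧-zeroʳ; ∨-zeroʳ; ∨-identityʳ; ¬-not)
  renaming (_≟_ to _≟ᵇ_)
open import Data.Fin using (Fin; zero; suc; toℕ; fromℕ<; _<?_; punchOut) renaming (_<_ to _<ᶠ_)
open import Data.Fin.Properties
  using (_≟_; any?; all?; toℕ-injective; toℕ-fromℕ<; toℕ<n; <-cmp; <⇒≢; punchOut-injective;
         injective⇒≤)
open import Data.Integer using (ℤ; +_; 0ℤ; 1ℤ; +≤+; _/ℕ_)
import Data.Integer as ℤ
open import Data.Integer.DivMod using ([n/ℕd]*d≤n; n<s[n/ℕd]*d; div-pos-is-/ℕ)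
import Data.Integer.Properties as ℤₚ
import Data.Integer.Tactic.RingSolver as ℤ-Solver
open import Data.List using (List; []; _∷_; length; lookup; allFin; map; filter; _++_)
open import Data.List.Membership.DecPropositional using (_∈?_)
open import Data.List.Membership.Propositional using (_∈_; _∉_)
open import Data.List.Membership.Propositional.Properties
  using (∈-lookup; ∈-map⁺; ∈-map⁻; ∈-++⁺ˡ; ∈-++⁺ʳ; ∈-++⁻; ∈-filter⁺; ∈-filter⁻;
         ∈-cartesianProduct⁺; ∈-allFin)
open import Data.List.Properties using (length-++; length-map; length-tabulate)
open import Data.List.Relation.Unary.All as All using (All)
import Data.List.Relation.Unary.All.Properties as All
open import Data.List.Relation.Unary.AllPairs using ([]; _∷_)
open import Data.List.Relation.Unary.Any using (index)
open import Data.List.Relation.Unary.Any.Properties using (lookup-index)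
open import Data.List.Relation.Unary.Unique.Propositional using (Unique)
import Data.List.Relation.Unary.Unique.Propositional.Properties as Unique
open import Data.Nat using (ℕ; zero; suc; _+_; _*_; _∸_; _<_; z≤n; NonZero) renaming (_≤_ to _≤ℕ_)
import Data.Nat.Properties as ℕₚ
import Data.Nat.Tactic.RingSolver as ℕ-Solver
open import Data.Product using (∃; ∃-syntax; Σ-syntax; _×_; _,_; proj₁; proj₂)
open import Data.Rational.Unnormalised using (mkℚᵘ; _/_; _≤_; *≤*; ceiling; 1ℚᵘ)
  renaming (_*_ to _*ℚ_; _-_ to _-ℚ_)
import Data.Rational.Unnormalised.Properties as ℚᵘₚ
open import Data.Sum using (_⊎_; inj₁; inj₂)
open import Data.Vec.Functional as Vector using (Vector; head; tail; updateAt)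
open import Data.Vec.Functional.Properties using (updateAt-updates; updateAt-minimal)
open import Function using (_∘_; const; id)
open import Function.Definitions using (Injective)
open import Level using (0ℓ)
open import Relation.Binary
  using (Rel; Reflexive; DecidableEquality; tri<; tri≈; tri>)
open import Relation.Binary.PropositionalEquality
  using (_≡_; _≢_; _≗_; refl; sym; trans; cong; cong₂; subst; ≢-sym)
open import Relation.Nullary using (Dec; yes; no; ¬_; contradiction; does)
open import Relation.Nullary.Decidable
  using (map′; _×-dec_; _→-dec_; _⊎-dec_; ¬?; decidable-stable; dec-true; dec-false)
open import Relation.Unary using (Pred; Decidable)

-- Existence of ρ

-- Without function extensionality, a search over functions reaches each of them only up to
-- pointwise equality, so predicates are required to respect `_≈_`.
Searchable : {A : Set} → Rel A 0ℓ → Set₁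
Searchable {A} _≈_ =
  (P : Pred A 0ℓ) → (∀ {x y} → x ≈ y → P x → P y) → Decidable P → Dec (∃ P)

searchFin : ∀ {n} → Searchable {Fin n} _≡_
searchFin P _ = any?

searchVector : ∀ {A : Set} {_≈_ : Rel A 0ℓ} → Reflexive _≈_ → Searchable _≈_ →
               ∀ n → Searchable {Vector A n} (λ f g → ∀ i → f i ≈ g i)
searchVector _ _ zero P respects P? =
  -- All vectors of length zero agree pointwise, so testing one of them decides the matter.
  map′ (λ p → _ , p) (λ (_ , p) → respects (λ ()) p) (P? λ ())
searchVector {_≈_ = _≈_} ≈-refl search (suc n) P respects P? =
  map′ (λ (x , f , p) → x Vector.∷ f , p)
       (λ (f , p) → head f , tail f , respects (split f) p)
       (search (λ x → ∃ λ f → P (x Vector.∷ f))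
          (λ x≈y (f , p) → f , respects (λ { zero → x≈y ; (suc _) → ≈-refl }) p)
          (λ x → searchVector ≈-refl search n (λ f → P (x Vector.∷ f))
             (λ f≈g → respects (λ { zero → ≈-refl ; (suc i) → f≈g i }))
             (λ f → P? (x Vector.∷ f))))
  where
  split : ∀ f i → f i ≈ (head f Vector.∷ tail f) i
  split f zero    = ≈-refl
  split f (suc _) = ≈-refl

searchBool : Searchable {Bool} _≡_
searchBool P _ P? =
  map′ (λ { (inj₁ p) → false , p ; (inj₂ p) → true , p })
       (λ { (false , p) → inj₁ p ; (true , p) → inj₂ p })
       (P? false ⊎-dec P? true)

searchMap : ∀ {m n} → Searchable {Vector (Fin m) n} _≗_
searchMap = searchVector refl searchFin _

injective? : ∀ {n} {C : Set} → DecidableEquality C → (f : Fin n → C) → Dec (Injective _≡_ _≡_ f)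
injective? _≟ᶜ_ f =
  map′ (λ inj {u} {v} → inj u v) (λ inj u v → inj)
       (all? λ u → all? λ v → (f u ≟ᶜ f v) →-dec (u ≟ v))

-- Only the partition into colour classes matters, so each colour is replaced by a vertex that
-- carries it. This leaves finitely many colourings to search although colours range over ℕ.
compress : ∀ {m} (c : Fin m → ℕ) →
           ∃[ c′ ] (∀ u v → c′ u ≡ c′ v → c u ≡ c v) ×
                   (∀ u v → c u ≡ c v → c′ u ≡ c′ v)
compress {m} c = (λ v → rep v (c v)) , reflects , preserves
  where
  rep : Fin m → ℕ → Fin m
  rep v x with any? (λ w → c w ℕₚ.≟ x)
  ... | yes (w , _) = w
  -- A default for numbers that are not values of `c`; it is never reached at `x = c v`.
  ... | no _        = v

  c-rep : ∀ v → c (rep v (c v)) ≡ c v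
  c-rep v with any? (λ w → c w ℕₚ.≟ c v)
  ... | yes (_ , eq) = eq
  ... | no _         = refl

  rep-const : ∀ u v x → c u ≡ x → rep u x ≡ rep v x
  rep-const u v x cu≡x with any? (λ w → c w ℕₚ.≟ x)
  ... | yes _ = refl
  ... | no ∄w = contradiction (u , cu≡x) ∄w

  reflects : ∀ u v → rep u (c u) ≡ rep v (c v) → c u ≡ c v
  reflects u v eq = trans (sym (c-rep u)) (trans (cong c eq) (c-rep v))

  preserves : ∀ u v → c u ≡ c v → rep u (c u) ≡ rep v (c v)
  preserves u v eq = trans (rep-const u v (c u) refl) (cong (rep v) eq)

-- Decidability of forcing a rainbow copy

module _ {n m : ℕ} (H : Graph n) where

  isInducedCopy? : (G : Graph m) → Decidable (IsInducedCopy H G)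
  isInducedCopy? G f =
    injective? _≟_ f ×-dec all? λ u → all? λ v → adj G (f u) (f v) ≟ᵇ adj H u v

  proper? : ∀ {C : Set} (_≟ᶜ_ : DecidableEquality C) (G : Graph m) →
            Decidable (Proper {C = C} G)
  proper? _≟ᶜ_ G c =
    all? λ u → all? λ v → (adj G u v ≟ᵇ true) →-dec ¬? (c u ≟ᶜ c v)

  hasRainbowCopy? : ∀ {C : Set} (_≟ᶜ_ : DecidableEquality C) (G : Graph m) →
                    Decidable (HasRainbowCopy {C = C} H G)
  hasRainbowCopy? _≟ᶜ_ G c = searchMap _ respects
    λ f → isInducedCopy? G f ×-dec injective? _≟ᶜ_ (c ∘ f)
    where
    respects : ∀ {f g : Fin n → Fin m} → f ≗ g →
               IsInducedCopy H G f × Injective _≡_ _≡_ (c ∘ f) →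
               IsInducedCopy H G g × Injective _≡_ _≡_ (c ∘ g)
    respects f≗g ((f-inj , f-adj) , cf-inj) =
      ( (λ {u} {v} eq → f-inj (trans (f≗g u) (trans eq (sym (f≗g v)))))
      , (λ u v → trans (sym (cong₂ (adj G) (f≗g u) (f≗g v))) (f-adj u v)) )
      , λ {u} {v} eq → cf-inj (trans (cong c (f≗g u)) (trans eq (sym (cong c (f≗g v)))))

  ForcesRainbowFin : Graph m → Set
  ForcesRainbowFin G = (c : Fin m → Fin m) → Proper G c → HasRainbowCopy H G c

  forcesRainbowFin? : Decidable ForcesRainbowFin
  forcesRainbowFin? G = map′
    (λ ∄bad c prop → decidable-stable (hasRainbowCopy? _≟_ G c) λ ¬copy → ∄bad (c , prop , ¬copy))
    (λ forces (c , prop , ¬copy) → ¬copy (forces c prop))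
    (¬? (searchMap Bad respects λ c → proper? _≟_ G c ×-dec ¬? (hasRainbowCopy? _≟_ G c)))
    where
    Bad : Pred (Fin m → Fin m) 0ℓ
    Bad c = Proper G c × ¬ HasRainbowCopy H G c

    respects : ∀ {c d} → c ≗ d → Bad c → Bad d
    respects c≗d (prop , ¬copy) =
      (λ u v uv eq → prop u v uv (trans (c≗d u) (trans eq (sym (c≗d v))))) ,
      λ (f , ind , inj) → ¬copy
        (f , ind , λ {u} {v} eq → inj (trans (sym (c≗d (f u))) (trans eq (c≗d (f v)))))

  -- Properness passes to the compressed colouring by `reflects`; the rainbow property of the copy
  -- found comes back by `preserves`.
  forcesRainbow? : Decidable (ForcesRainbow {m = m} H)
  forcesRainbow? G = map′ to from (forcesRainbowFin? G)
    where
    to : ForcesRainbowFin G → ForcesRainbow H G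
    to forces c prop =
      let c′ , reflects , preserves = compress c
          f , ind , inj = forces c′ λ u v uv eq → prop u v uv (reflects u v eq)
      in  f , ind , λ {u} {v} eq → inj (preserves (f u) (f v) eq)

    from : ForcesRainbow H G → ForcesRainbowFin G
    from forces c prop =
      let f , ind , inj = forces (toℕ ∘ c) λ u v uv eq → prop u v uv (toℕ-injective eq)
      in  f , ind , λ eq → inj (cong toℕ eq)

  forcesRainbow-respects : {G G′ : Graph m} → (∀ u v → adj G u v ≡ adj G′ u v) →
                       ForcesRainbow H G → ForcesRainbow H G′
  forcesRainbow-respects G≈G′ forces c prop =
    let f , (f-inj , f-adj) , inj =
          forces c λ u v uv → prop u v (trans (sym (G≈G′ u v)) uv)
    in  f , (f-inj , λ u v → trans (sym (G≈G′ (f u) (f v))) (f-adj u v)) , inj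

existsForcing? : ∀ {n} (H : Graph n) m → Dec (Σ[ G ∈ Graph m ] ForcesRainbow H G)
existsForcing? H m = map′
  (λ (_ , gr , forces) → toGraph gr , forces)
  (λ (G , forces) → adj G , (symm G , irrefl G) , forces)
  (searchVector (λ _ → refl) (searchVector refl searchBool m) m Forcing respects forcing?)
  where
  IsGraph : Pred (Fin m → Fin m → Bool) 0ℓ
  IsGraph a = (∀ u v → a u v ≡ a v u) × (∀ u → a u u ≡ false)

  toGraph : ∀ {a} → IsGraph a → Graph m
  toGraph {a} (sy , ir) = record { adj = a ; symm = sy ; irrefl = ir }

  Forcing : Pred (Fin m → Fin m → Bool) 0ℓ
  Forcing a = Σ[ gr ∈ IsGraph a ] ForcesRainbow H (toGraph gr)

  respects : ∀ {a b} → (∀ u v → a u v ≡ b u v) → Forcing a → Forcing b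
  respects {a} {b} a≈b ((sy , ir) , forces) =
    gr , forcesRainbow-respects H {toGraph (sy , ir)} {toGraph gr} a≈b forces
    where
    gr : IsGraph b
    gr = (λ u v → trans (sym (a≈b u v)) (trans (sy u v) (a≈b v u)))
       , (λ u → trans (sym (a≈b u u)) (ir u))

  forcing? : Decidable Forcing
  forcing? a with (all? λ u → all? λ v → a u v ≟ᵇ a v u) ×-dec (all? λ u → a u u ≟ᵇ false)
  -- `ForcesRainbow` sees a graph only through `adj`, so the proof of `IsGraph a` inside a given
  -- `Forcing a` may differ from `gr`.
  ... | yes gr = map′ (gr ,_) proj₂ (forcesRainbow? H (toGraph gr))
  ... | no ¬gr = no (¬gr ∘ proj₁)

-- This is what the decision procedures are for: constructively, a least witness is found by testing
-- every number up to a known witness.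
least : {P : Pred ℕ 0ℓ} → Decidable P → ∀ {m} → P m → ∃ (IsLeast P)
least {P} P? {m} pm with below (suc m)
  where
  below : ∀ k → ∃ (IsLeast P) ⊎ (∀ j → j < k → ¬ P j)
  below zero = inj₂ λ _ ()
  below (suc k) with below k
  ... | inj₁ found = inj₁ found
  ... | inj₂ none with P? k
  ...   | yes pk = inj₁ (k , pk , λ j pj → ℕₚ.≮⇒≥ λ j<k → none j j<k pj)
  ...   | no ¬pk = inj₂ λ j j<1+k → case-≤ j (ℕₚ.m≤n⇒m<n∨m≡n (ℕₚ.≤-pred j<1+k))
    where
    case-≤ : ∀ j → j < k ⊎ j ≡ k → ¬ P j
    case-≤ j (inj₁ j<k) = none j j<k
    case-≤ j (inj₂ refl) = ¬pk
... | inj₁ found = found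
... | inj₂ none  = contradiction pm (none m ℕₚ.≤-refl)

-- Upper bound

-- Pigeonhole: `punchOut` at the missed value would squeeze `Fin n` injectively into a set with one
-- element fewer.
¬injective-missing : ∀ {n} (f : Fin n → Fin n) (i : Fin n) → (∀ j → f j ≢ i) →
                     ¬ Injective _≡_ _≡_ f
¬injective-missing {suc n} f i f≢i f-inj = ℕₚ.1+n≰n (injective⇒≤ punched-inj)
  where
  i≢f : ∀ j → i ≢ f j
  i≢f j = ≢-sym (f≢i j)
  punched-inj : Injective _≡_ _≡_ (λ j → punchOut (i≢f j))
  punched-inj {j} {k} eq = f-inj (punchOut-injective (i≢f j) (i≢f k) eq)

-- Indexes the copies of `i`: one for `i` itself and one for each earlier non-neighbour. Each
-- non-edge is thus charged to its later endpoint.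
TaggedBy : ∀ {n} → Graph n → Fin n → Fin n → Set
TaggedBy H i j = j ≡ i ⊎ (j <ᶠ i × adj H j i ≡ false)

-- `π` gives the vertex of `H` that a vertex of the blow-up copies and `τ` gives its tag; `copy`
-- guarantees enough copies of each `i`.
module BlowUp {n M : ℕ} (H : Graph n) (π τ : Fin M → Fin n)
  (copy : ∀ i j → TaggedBy H i j → ∃[ x ] τ x ≡ j × π x ≡ i)
  where

  twin : Fin M → Fin M → Bool
  twin x y = does (π x ≟ π y) ∧ not (does (x ≟ y))

  twin-sym : ∀ x y → twin x y ≡ twin y x
  twin-sym x y with π x ≟ π y | π y ≟ π x | x ≟ y | y ≟ x
  ... | yes p | no q  | _     | _     = contradiction (sym p) q
  ... | no p  | yes q | _     | _     = contradiction (sym q) p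
  ... | _     | _     | yes r | no s  = contradiction (sym r) s
  ... | _     | _     | no r  | yes s = contradiction (sym s) r
  ... | yes _ | yes _ | yes _ | yes _ = refl
  ... | yes _ | yes _ | no _  | no _  = refl
  ... | no _  | no _  | _     | _     = refl

  blowUp : Graph M
  blowUp = record
    { adj    = λ x y → adj H (π x) (π y) ∨ twin x y
    ; symm   = λ x y → cong₂ _∨_ (symm H (π x) (π y)) (twin-sym x y)
    ; irrefl = λ x → trans (cong₂ _∨_ (irrefl H (π x))
                       (cong (λ b → does (π x ≟ π x) ∧ not b) (dec-true (x ≟ x) refl)))
                       (∧-zeroʳ _)
    }

  twin-adj : ∀ {x y} → π x ≡ π y → x ≢ y → adj blowUp x y ≡ true
  twin-adj {x} {y} πx≡πy x≢y = trans
    (cong (adj H (π x) (π y) ∨_)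
       (cong₂ (λ a b → a ∧ not b) (dec-true (π x ≟ π y) πx≡πy) (dec-false (x ≟ y) x≢y)))
    (∨-zeroʳ _)

  distinct-adj : ∀ {x y} → π x ≢ π y → adj blowUp x y ≡ adj H (π x) (π y)
  distinct-adj {x} {y} πx≢πy = trans
    (cong (λ a → adj H (π x) (π y) ∨ a ∧ not (does (x ≟ y))) (dec-false (π x ≟ π y) πx≢πy))
    (∨-identityʳ _)

  -- The edges added by `twin` stay inside a fibre of `π`, and a section meets each fibre only once.
  section-isInducedCopy : (f : Fin n → Fin M) → (∀ j → π (f j) ≡ j) → IsInducedCopy H blowUp f
  section-isInducedCopy f πf = f-inj , f-adj
    where
    f-inj : Injective _≡_ _≡_ f
    f-inj {u} {v} eq = trans (sym (πf u)) (trans (cong π eq) (πf v))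
    f-adj : ∀ u v → adj blowUp (f u) (f v) ≡ adj H u v
    f-adj u v with u ≟ v
    ... | yes refl = trans (irrefl blowUp (f u)) (sym (irrefl H u))
    ... | no u≢v   = trans
      (distinct-adj λ eq → u≢v (trans (sym (πf u)) (trans eq (πf v))))
      (cong₂ (adj H) (πf u) (πf v))

  module _ (c : Fin M → ℕ) (prop : Proper blowUp c) where

    -- If every copy of i were blocked, sending each j tagging a copy of i to a blocker
    -- of that copy, and every other j to itself, would inject Fin n into itself
    -- avoiding i, because distinct copies of i have distinct colours.
    freshCopy : (f : Fin n → Fin M) → (∀ j → π (f j) ≡ j) → ∀ i →
                ∃[ x ] π x ≡ i × (∀ j → j <ᶠ i → c (f j) ≢ c x)
    freshCopy f πf i with any? (λ x → (π x ≟ i) ×-dec ¬? (any? (blocks? x)))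
      where
      blocks? : ∀ x j → Dec (j <ᶠ i × c (f j) ≡ c x)
      blocks? x j = (j <? i) ×-dec (c (f j) ℕₚ.≟ c x)
    ... | yes (x , πx≡i , free) = x , πx≡i , λ j j<i eq → free (j , j<i , eq)
    ... | no ∄free = contradiction (λ {j} {k} → ψ-inj j k)
      (¬injective-missing (proj₁ ∘ ψ) i λ j → ψ≢i (proj₂ (ψ j)))
      where
      tag? : Decidable (TaggedBy H i)
      tag? j = (j ≟ i) ⊎-dec ((j <? i) ×-dec (adj H j i ≟ᵇ false))

      blocked : ∀ {x} → π x ≡ i → ∃[ j ] j <ᶠ i × c (f j) ≡ c x
      blocked {x} πx≡i = decidable-stable (any? λ j → (j <? i) ×-dec (c (f j) ℕₚ.≟ c x))
        λ free → ∄free (x , πx≡i , free)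

      -- An earlier neighbour of `i` is joined to all copies of `i` and cannot block any. A blocker
      -- is therefore itself a tag of `i`, which keeps the values of `move` apart from those of
      -- `stay`.
      blocker-nonAdj : ∀ {x j} → π x ≡ i → j <ᶠ i → c (f j) ≡ c x → adj H j i ≡ false
      blocker-nonAdj {x} {j} πx≡i j<i eq = ¬-not λ ji → prop (f j) x
        (trans (distinct-adj λ e → <⇒≢ j<i (trans (sym (πf j)) (trans e πx≡i)))
               (trans (cong₂ (adj H) (πf j) πx≡i) ji))
        eq

      -- Stores with each value of `ψ` the reason for it, so that injectivity becomes a case
      -- analysis.
      data Image (j : Fin n) : Fin n → Set where
        move : ∀ {k} (x : Fin M) → τ x ≡ j → π x ≡ i → k <ᶠ i → c (f k) ≡ c x → Image j k
        stay : ¬ TaggedBy H i j → Image j j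

      ψ : ∀ j → ∃ (Image j)
      ψ j with tag? j
      ... | no ¬t = j , stay ¬t
      ... | yes t =
        let x , τx≡j , πx≡i = copy i j t
            k , k<i , eq    = blocked πx≡i
        in  k , move x τx≡j πx≡i k<i eq

      ψ≢i : ∀ {j k} → Image j k → k ≢ i
      ψ≢i (move _ _ _ k<i _) = <⇒≢ k<i
      ψ≢i (stay ¬t)          = ¬t ∘ inj₁

      image-inj : ∀ {j j′ k} → Image j k → Image j′ k → j ≡ j′
      image-inj (move x refl πx≡i _ eq) (move y refl πy≡i _ eq′) with x ≟ y
      ... | yes refl = refl
      ... | no x≢y   = contradiction (trans (sym eq) eq′)
        (prop x y (twin-adj (trans πx≡i (sym πy≡i)) x≢y))
      image-inj (move x _ πx≡i k<i eq) (stay ¬t) =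
        contradiction (inj₂ (k<i , blocker-nonAdj πx≡i k<i eq)) ¬t
      image-inj (stay ¬t) (move x _ πx≡i k<i eq) =
        contradiction (inj₂ (k<i , blocker-nonAdj πx≡i k<i eq)) ¬t
      image-inj (stay _) (stay _) = refl

      ψ-inj : ∀ j k → proj₁ (ψ j) ≡ proj₁ (ψ k) → j ≡ k
      ψ-inj j k eq = image-inj (proj₂ (ψ j)) (subst (Image k) (sym eq) (proj₂ (ψ k)))

    -- `f` is a full section at every stage, so `freshCopy` always applies. Passing from `k` to
    -- `suc k` changes only the copy of the vertex with index `k`, which leaves the pairs settled
    -- before untouched.
    greedy : ∀ k → k ≤ℕ n →
             Σ[ f ∈ (Fin n → Fin M) ] (∀ j → π (f j) ≡ j) ×
               (∀ i j → j <ᶠ i → toℕ i < k → c (f j) ≢ c (f i))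
    greedy zero _ = (λ j → proj₁ (copy j j (inj₁ refl)))
                  , (λ j → proj₂ (proj₂ (copy j j (inj₁ refl))))
                  , λ _ _ _ ()
    greedy (suc k) k<n = f′ , πf′ , rainbow
      where
      prev = greedy k (ℕₚ.<⇒≤ k<n)
      f = proj₁ prev
      πf = proj₁ (proj₂ prev)
      i₀ : Fin n
      i₀ = fromℕ< k<n
      fresh = freshCopy f πf i₀
      x = proj₁ fresh
      f′ : Fin n → Fin M
      f′ = updateAt f i₀ (const x)
      f′-new : f′ i₀ ≡ x
      f′-new = updateAt-updates i₀ f
      f′-old : ∀ {j} → j ≢ i₀ → f′ j ≡ f j
      f′-old {j} = updateAt-minimal j i₀ f
      πf′ : ∀ j → π (f′ j) ≡ j
      πf′ j with j ≟ i₀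
      ... | yes refl = trans (cong π f′-new) (proj₁ (proj₂ fresh))
      ... | no j≢i₀  = trans (cong π (f′-old j≢i₀)) (πf j)
      rainbow : ∀ i j → j <ᶠ i → toℕ i < suc k → c (f′ j) ≢ c (f′ i)
      rainbow i j j<i i<1+k with i ≟ i₀
      ... | yes refl rewrite f′-new | f′-old (<⇒≢ j<i) = proj₂ (proj₂ fresh) j j<i
      ... | no i≢i₀ = λ eq → proj₂ (proj₂ prev) i j j<i i<k
        (trans (sym (cong c (f′-old j≢i₀))) (trans eq (cong c (f′-old i≢i₀))))
        where
        i<k : toℕ i < k
        i<k = ℕₚ.≤∧≢⇒< (ℕₚ.≤-pred i<1+k)
                λ eq → i≢i₀ (toℕ-injective (trans eq (sym (toℕ-fromℕ< k<n))))
        j≢i₀ : j ≢ i₀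
        j≢i₀ refl = ℕₚ.<-asym i<k (subst (_< toℕ i) (toℕ-fromℕ< k<n) j<i)

  blowUp-forces : ForcesRainbow H blowUp
  blowUp-forces c prop = f , section-isInducedCopy f πf , λ {u} {v} → inj u v
    where
    selection = greedy c prop n ℕₚ.≤-refl
    f = proj₁ selection
    πf = proj₁ (proj₂ selection)
    rainbow = proj₂ (proj₂ selection)
    inj : ∀ u v → c (f u) ≡ c (f v) → u ≡ v
    inj u v eq with <-cmp u v
    ... | tri< u<v _ _ = contradiction eq (rainbow v u u<v (toℕ<n v))
    ... | tri≈ _ u≡v _ = u≡v
    ... | tri> _ _ v<u = contradiction (sym eq) (rainbow u v v<u (toℕ<n u))

forcing-n+nonEdges : ∀ {n} (H : Graph n) →
                     Σ[ G ∈ Graph (n + length (nonEdges H)) ] ForcesRainbow H G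
forcing-n+nonEdges {n} H = subst (λ M → Σ[ G ∈ Graph M ] ForcesRainbow H G) length-L
  (BlowUp.blowUp H (proj₂ ∘ lookup L) (proj₁ ∘ lookup L) copy ,
   BlowUp.blowUp-forces H (proj₂ ∘ lookup L) (proj₁ ∘ lookup L) copy)
  where
  -- The vertices of the blow-up are the positions in `L`, and an entry `(j , i)` stands for the
  -- copy of `i` tagged by `j`. As `nonEdges` lists the smaller endpoint first, that endpoint is the
  -- tag.
  L : List (Fin n × Fin n)
  L = map (λ v → v , v) (allFin n) ++ nonEdges H

  length-L : length L ≡ n + length (nonEdges H)
  length-L = trans (length-++ (map (λ v → v , v) (allFin n)))
    (cong (_+ length (nonEdges H)) (trans (length-map _ (allFin n)) (length-tabulate {n = n} _)))

  ∈L : ∀ i j → TaggedBy H i j → (j , i) ∈ L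
  ∈L i .i (inj₁ refl)  = ∈-++⁺ˡ (∈-map⁺ _ (∈-allFin i))
  ∈L i j (inj₂ nonEdge) = ∈-++⁺ʳ (map _ (allFin n))
    (∈-filter⁺ _ (∈-cartesianProduct⁺ (∈-allFin j) (∈-allFin i)) nonEdge)

  copy : ∀ i j → TaggedBy H i j → ∃[ x ] proj₁ (lookup L x) ≡ j × proj₂ (lookup L x) ≡ i
  copy i j tag = let eq = sym (lookup-index (∈L i j tag)) in
    index (∈L i j tag) , cong proj₁ eq , cong proj₂ eq

-- Lower bound

lookup-injective : ∀ {A : Set} {xs : List A} → Unique xs → Injective _≡_ _≡_ (lookup xs)
lookup-injective {xs = _ ∷ _}  _         {zero}  {zero}  _  = refl
lookup-injective {xs = _ ∷ xs} (x∉ ∷ _)  {zero}  {suc j} eq =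
  contradiction eq (All.lookup x∉ (∈-lookup {xs = xs} j))
lookup-injective {xs = _ ∷ xs} (x∉ ∷ _)  {suc i} {zero}  eq =
  contradiction (sym eq) (All.lookup x∉ (∈-lookup {xs = xs} i))
lookup-injective {xs = _ ∷ _}  (_ ∷ xs!) {suc i} {suc j} eq =
  cong suc (lookup-injective xs! eq)

unique-length≤ : ∀ {k} {xs : List ℕ} → Unique xs → All (_< k) xs → length xs ≤ℕ k
unique-length≤ {xs = xs} xs! xs<k = injective⇒≤ {f = λ i → fromℕ< (bound i)} λ {i} {j} eq →
  lookup-injective xs!
    (trans (sym (toℕ-fromℕ< (bound i))) (trans (cong toℕ eq) (toℕ-fromℕ< (bound j))))
  where
  bound : ∀ i → lookup xs i < _
  bound i = All.lookup xs<k (∈-lookup {xs = xs} i)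

length-filter-∁ : ∀ {A : Set} {P : Pred A 0ℓ} (P? : Decidable P) xs →
                  length xs ≡ length (filter P? xs) + length (filter (¬? ∘ P?) xs)
length-filter-∁ P? [] = refl
length-filter-∁ P? (x ∷ xs) with ih ← length-filter-∁ P? xs | does (P? x)
... | true  = cong suc ih
... | false = trans (cong suc ih) (sym (ℕₚ.+-suc _ _))

module _ {m : ℕ} (G : Graph m) where

  toℕ-proper : Proper G toℕ
  toℕ-proper u v uv eq with refl ← toℕ-injective eq with () ← trans (sym uv) (irrefl G u)

  ProperOn : Pred (Fin m) 0ℓ → (Fin m → ℕ) → Set
  ProperOn P c = ∀ u v → P u → P v → adj G u v ≡ true → c u ≢ c v

  -- The shift by `k` separates the palettes when `a` stays below `k` on `P`, so edges leaving `P`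
  -- cause no conflict.
  glue : ∀ {P : Pred (Fin m) 0ℓ} → Decidable P → ℕ → (a b : Fin m → ℕ) → Fin m → ℕ
  glue P? k a b v with P? v
  ... | yes _ = a v
  ... | no _  = k + b v

  module _ {P : Pred (Fin m) 0ℓ} (P? : Decidable P) (k : ℕ) (a b : Fin m → ℕ) where

    glue-in : ∀ {v} → P v → glue P? k a b v ≡ a v
    glue-in {v} pv with P? v
    ... | yes _  = refl
    ... | no ¬pv = contradiction pv ¬pv

    glue-out : ∀ {v} → ¬ P v → glue P? k a b v ≡ k + b v
    glue-out {v} ¬pv with P? v
    ... | yes pv = contradiction pv ¬pv
    ... | no _   = refl

    glue-proper : ProperOn P a → (∀ v → P v → a v < k) → Proper G b →
                  Proper G (glue P? k a b)
    glue-proper a-proper a<k b-proper u v uv with P? u | P? v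
    ... | yes pu | yes pv = a-proper u v pu pv uv
    ... | yes pu | no _   = ℕₚ.<⇒≢ (ℕₚ.<-≤-trans (a<k u pu) (ℕₚ.m≤m+n k _))
    ... | no _   | yes pv = ≢-sym (ℕₚ.<⇒≢ (ℕₚ.<-≤-trans (a<k v pv) (ℕₚ.m≤m+n k _)))
    ... | no _   | no _   = b-proper u v uv ∘ ℕₚ.+-cancelˡ-≡ k _ _

-- Unions of rainbow copies

layerSum : ℕ → ℕ → ℕ → ℕ
layerSum n χ zero    = 0
layerSum n χ (suc k) = layerSum n χ k + (n ∸ k * χ)

module _ {n m χ : ℕ} {H : Graph n} {G : Graph m} where

  -- The copy is coloured through `H`, being induced; every other vertex receives a private colour
  -- at or above `χ`, which makes the colouring proper on all of `G`.
  copyColouring : Colorable H χ → ∀ {f} → IsInducedCopy H G f →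
                  ∃[ b ] Proper G b × (∀ u → b (f u) < χ)
  copyColouring (h , h-proper) {f} (f-inj , f-adj) =
    glue G inImage? χ h′ toℕ ,
    glue-proper G inImage? χ h′ toℕ h′-proper h′<χ
      (toℕ-proper G) ,
    λ u → subst (_< χ) (sym (glue-in G inImage? χ h′ toℕ (u , refl))) (h′<χ (f u) (u , refl))
    where
    InImage : Pred (Fin m) 0ℓ
    InImage v = ∃[ u ] f u ≡ v

    inImage? : Decidable InImage
    inImage? v = any? λ u → f u ≟ v

    h′ : Fin m → ℕ
    h′ v with inImage? v
    ... | yes (u , _) = toℕ (h u)
    -- A default off the copy, where `glue` never consults `h′`.
    ... | no _        = 0

    h′-image : ∀ u → h′ (f u) ≡ toℕ (h u)
    h′-image u with inImage? (f u)
    ... | yes (u′ , eq) = cong (toℕ ∘ h) (f-inj eq)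
    ... | no ∄u         = contradiction (u , refl) ∄u

    h′<χ : ∀ v → InImage v → h′ v < χ
    h′<χ _ (u , refl) = subst (_< χ) (sym (h′-image u)) (toℕ<n (h u))

    h′-proper : ProperOn G InImage h′
    h′-proper _ _ (u , refl) (w , refl) uw eq =
      h-proper u w (trans (sym (f-adj u w)) uw)
        (toℕ-injective (trans (sym (h′-image u)) (trans eq (h′-image w))))

  -- The colouring is proper on the whole of `G`, so that a rainbow copy can be demanded for it,
  -- while the bound on colours concerns `vertices` alone.
  record Layers (k : ℕ) : Set where
    field
      vertices : List (Fin m)
      unique   : Unique vertices
      size     : layerSum n χ k ≤ℕ length vertices
      colour   : Fin m → ℕ
      proper   : Proper G colour
      bounded  : ∀ {v} → v ∈ vertices → colour v < k * χ

  -- A rainbow copy for the present colouring is split into `old`, inside the set, and `new`,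
  -- outside it. The next colouring keeps the colours on the set and shifts `b` by `k * χ`
  -- elsewhere, so `new` is coloured below `k * χ + χ`.
  addLayer : Colorable H χ → ForcesRainbow H G → ∀ {k} → Layers k → Layers (suc k)
  addLayer h forces {k} S = record
    { vertices = vertices ++ map f new
    ; unique   = Unique.++⁺ unique (Unique.map⁺ f-inj (Unique.filter⁺ _ (Unique.allFin⁺ n)))
                   λ (v∈S , v∈new) → new-fresh v∈new v∈S
    ; size     = subst (layerSum n χ (suc k) ≤ℕ_) (sym size-eq) (ℕₚ.+-mono-≤ size new-size)
    ; colour   = colour′
    ; proper   = glue-proper G seen? (k * χ) colour b
                   (λ u v _ _ → proper u v) (λ _ → bounded) b-proper
    ; bounded  = λ v∈ → bounded′ (∈-++⁻ vertices v∈)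
    }
    where
    open Layers S
    rainbow = forces colour proper
    f = proj₁ rainbow
    f-copy = proj₁ (proj₂ rainbow)
    f-inj = proj₁ f-copy
    cf-inj = proj₂ (proj₂ rainbow)
    layer = copyColouring h f-copy
    b = proj₁ layer
    b-proper = proj₁ (proj₂ layer)
    b<χ = proj₂ (proj₂ layer)

    seen? : Decidable (_∈ vertices)
    seen? v = _∈?_ _≟_ v vertices

    colour′ : Fin m → ℕ
    colour′ = glue G seen? (k * χ) colour b

    old new : List (Fin n)
    old = filter (seen? ∘ f) (allFin n)
    new = filter (¬? ∘ seen? ∘ f) (allFin n)

    new-fresh : ∀ {v} → v ∈ map f new → v ∉ vertices
    new-fresh v∈ with u , u∈ , refl ← ∈-map⁻ f v∈ = proj₂ (∈-filter⁻ _ {xs = allFin n} u∈)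

    -- The copy is rainbow, so its vertices inside the set have distinct colours, all below `k * χ`.
    old-size : length old ≤ℕ k * χ
    old-size = subst (_≤ℕ k * χ) (length-map (colour ∘ f) old)
      (unique-length≤ (Unique.map⁺ cf-inj (Unique.filter⁺ _ (Unique.allFin⁺ n)))
        (All.map⁺ (All.map bounded (All.all-filter (seen? ∘ f) (allFin n)))))

    new-size : n ∸ k * χ ≤ℕ length new
    new-size = ℕₚ.m≤n+o⇒m∸n≤o n (k * χ) (begin
      n                       ≡⟨ length-tabulate {n = n} id ⟨
      length (allFin n)       ≡⟨ length-filter-∁ (seen? ∘ f) (allFin n) ⟩
      length old + length new ≤⟨ ℕₚ.+-monoˡ-≤ (length new) old-size ⟩
      k * χ + length new      ∎)
      where open ℕₚ.≤-Reasoning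

    size-eq : length (vertices ++ map f new) ≡ length vertices + length new
    size-eq = trans (length-++ vertices) (cong (λ l → length vertices + l) (length-map f new))

    bounded′ : ∀ {v} → v ∈ vertices ⊎ v ∈ map f new → colour′ v < suc k * χ
    bounded′ (inj₁ v∈S) rewrite glue-in G seen? (k * χ) colour b v∈S =
      ℕₚ.<-≤-trans (bounded v∈S) (ℕₚ.m≤n+m (k * χ) χ)
    bounded′ {v} (inj₂ v∈new) rewrite glue-out G seen? (k * χ) colour b (new-fresh v∈new)
      with u , _ , refl ← ∈-map⁻ f v∈new =
      subst (k * χ + b v <_) (ℕₚ.+-comm (k * χ) χ) (ℕₚ.+-monoʳ-< (k * χ) (b<χ u))

  layers : Colorable H χ → ForcesRainbow H G → ∀ k → Layers k
  layers h forces zero = record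
    { vertices = [] ; unique = [] ; size = z≤n
    ; colour   = toℕ
    ; proper   = toℕ-proper G
    ; bounded  = λ () }
  layers h forces (suc k) = addLayer h forces (layers h forces k)

  layerSum≤ : Colorable H χ → ForcesRainbow H G → ∀ k → layerSum n χ k ≤ℕ m
  layerSum≤ h forces k = ℕₚ.≤-trans size (injective⇒≤ (lookup-injective unique))
    where open Layers (layers h forces k)

-- 2 Σ_{i<k} (n − i χ) = 2 k n − χ k (k − 1), with the negative part moved
-- across; the truncation in layerSum can only enlarge the sum.
layerSum≥ : ∀ n χ k → 2 * (k * n) + χ * k ≤ℕ 2 * layerSum n χ k + χ * (k * k)
layerSum≥ n χ zero = ℕₚ.≤-refl
layerSum≥ n χ (suc k) = begin
  2 * (suc k * n) + χ * suc k
    ≡⟨ lhs k n χ ⟩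
  (2 * (k * n) + χ * k) + (2 * n + χ)
    ≤⟨ ℕₚ.+-mono-≤ (layerSum≥ n χ k)
         (ℕₚ.+-monoˡ-≤ χ (ℕₚ.*-monoʳ-≤ 2 (ℕₚ.m≤n+m∸n n (k * χ)))) ⟩
  (2 * layerSum n χ k + χ * (k * k)) + (2 * (k * χ + (n ∸ k * χ)) + χ)
    ≡⟨ rhs (layerSum n χ k) (n ∸ k * χ) k χ ⟩
  2 * layerSum n χ (suc k) + χ * (suc k * suc k) ∎
  where
  open ℕₚ.≤-Reasoning
  lhs : ∀ k n χ → 2 * (suc k * n) + χ * suc k ≡ (2 * (k * n) + χ * k) + (2 * n + χ)
  lhs = ℕ-Solver.solve-∀
  rhs : ∀ s d k χ → (2 * s + χ * (k * k)) + (2 * (k * χ + d) + χ) ≡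
                    2 * (s + d) + χ * (suc k * suc k)
  rhs = ℕ-Solver.solve-∀

-- Ceilings and the rational form of the lower bound

module _ (a : ℤ) (d : ℕ) where

  private
    -- The floor of `- a / suc d`, whose negative is the ceiling of `a / suc d`.
    q : ℤ
    q = (ℤ.- a) /ℕ suc d

    ceiling≡-q : ceiling (mkℚᵘ a d) ≡ ℤ.- q
    ceiling≡-q = cong ℤ.-_ (div-pos-is-/ℕ (ℤ.- a) (suc d))

  ≤ceiling* : a ℤ.≤ ceiling (mkℚᵘ a d) ℤ.* + suc d
  ≤ceiling* rewrite ceiling≡-q = begin
    a                     ≡⟨ ℤₚ.neg-involutive a ⟨
    ℤ.- (ℤ.- a)           ≤⟨ ℤₚ.neg-mono-≤ ([n/ℕd]*d≤n (ℤ.- a) (suc d)) ⟩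
    ℤ.- (q ℤ.* + suc d)   ≡⟨ ℤₚ.neg-distribˡ-* q (+ suc d) ⟩
    (ℤ.- q) ℤ.* + suc d   ∎
    where open ℤₚ.≤-Reasoning

  pred-ceiling*< : ℤ.pred (ceiling (mkℚᵘ a d)) ℤ.* + suc d ℤ.< a
  pred-ceiling*< rewrite ceiling≡-q = begin-strict
    ℤ.pred (ℤ.- q) ℤ.* + suc d      ≡⟨ ℤₚ.*-comm _ (+ suc d) ⟩
    + suc d ℤ.* ℤ.pred (ℤ.- q)      ≡⟨ lemma q (+ suc d) ⟩
    ℤ.- (ℤ.suc q ℤ.* + suc d)       <⟨ ℤₚ.neg-mono-< (n<s[n/ℕd]*d (ℤ.- a) (suc d)) ⟩
    ℤ.- (ℤ.- a)                     ≡⟨ ℤₚ.neg-involutive a ⟩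
    a                               ∎
    where
    open ℤₚ.≤-Reasoning
    lemma : ∀ q e → e ℤ.* (ℤ.-1ℤ ℤ.+ ℤ.- q) ≡ ℤ.- ((1ℤ ℤ.+ q) ℤ.* e)
    lemma = ℤ-Solver.solve-∀

0≤ceiling : ∀ n d → 0ℤ ℤ.≤ ceiling (mkℚᵘ (+ n) d)
0≤ceiling n d = ℤₚ.*-cancelʳ-≤-pos 0ℤ _ (+ suc d) (ℤₚ.≤-trans (+≤+ z≤n) (≤ceiling* (+ n) d))

-- From `(K - 2) * suc d < a - suc d ≤ C * suc d` follows `K - 2 < C`, hence `K - 1 ≤ C` for
-- integers.
pred-ceiling≤ceiling-pred : ∀ a d → ℤ.pred (ceiling (mkℚᵘ a d)) ℤ.≤ ceiling (mkℚᵘ a d -ℚ 1ℚᵘ)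
-- The denominator of the difference computes to `suc (d * 1)`; the rewrite restores `suc d`.
pred-ceiling≤ceiling-pred a d rewrite ℕₚ.*-identityʳ d = begin
  ℤ.pred K                  ≡⟨ ℤₚ.suc-pred (ℤ.pred K) ⟨
  ℤ.suc (ℤ.pred (ℤ.pred K)) ≤⟨ ℤₚ.i<j⇒suc[i]≤j
                                  (ℤₚ.*-cancelʳ-<-nonNeg {ℤ.pred (ℤ.pred K)} {C} (+ suc d) scaled) ⟩
  C                         ∎
  where
  open ℤₚ.≤-Reasoning
  b = a ℤ.* 1ℤ ℤ.+ ℤ.-1ℤ ℤ.* + suc d
  K = ceiling (mkℚᵘ a d)
  C = ceiling (mkℚᵘ b d)
  expand : ∀ K e → (ℤ.-1ℤ ℤ.+ (ℤ.-1ℤ ℤ.+ K)) ℤ.* e ≡ (ℤ.-1ℤ ℤ.+ K) ℤ.* e ℤ.+ ℤ.-1ℤ ℤ.* e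
  expand = ℤ-Solver.solve-∀
  scaled : ℤ.pred (ℤ.pred K) ℤ.* + suc d ℤ.< C ℤ.* + suc d
  scaled = begin-strict
    ℤ.pred (ℤ.pred K) ℤ.* + suc d                 ≡⟨ expand K (+ suc d) ⟩
    ℤ.pred K ℤ.* + suc d ℤ.+ ℤ.-1ℤ ℤ.* + suc d    <⟨ ℤₚ.+-monoˡ-< _ (pred-ceiling*< a d) ⟩
    a ℤ.+ ℤ.-1ℤ ℤ.* + suc d                       ≡⟨ cong (ℤ._+ ℤ.-1ℤ ℤ.* + suc d) (ℤₚ.*-identityʳ a) ⟨
    b                                             ≤⟨ ≤ceiling* b d ⟩
    C ℤ.* + suc d                                 ∎

-- The number of layers is `K` itself. After clearing the denominator 2, `C` is subtracted with the
-- nonnegative coefficient `k * χ`, so replacing it by `K - 1` can only enlarge the left side;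
-- `layerSum≥` then finishes.
layerSum≥-ℚ : ∀ n χ {K C} → 0ℤ ℤ.≤ K → ℤ.pred K ℤ.≤ C → ∃[ k ]
  ((K / 1) *ℚ (+ n / 1 -ℚ (+ χ / 2) *ℚ (C / 1)) ≤ + layerSum n χ k / 1)
layerSum≥-ℚ n χ {+ k} {C} _ K-1≤C = k , *≤* (begin
  + k ℤ.* (+ n ℤ.* + 2 ℤ.+ (ℤ.- (+ χ ℤ.* C)) ℤ.* 1ℤ) ℤ.* 1ℤ
    ≡⟨ lhs (+ n) (+ χ) (+ k) C ⟩
  + 2 ℤ.* (+ k ℤ.* + n) ℤ.- (+ k ℤ.* + χ) ℤ.* C
    ≤⟨ ℤₚ.+-monoʳ-≤ (+ 2 ℤ.* (+ k ℤ.* + n)) (ℤₚ.neg-mono-≤ kχ[k-1]≤kχC) ⟩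
  + 2 ℤ.* (+ k ℤ.* + n) ℤ.- (+ k ℤ.* + χ) ℤ.* ℤ.pred (+ k)
    ≡⟨ middle (+ n) (+ χ) (+ k) ⟩
  (+ 2 ℤ.* (+ k ℤ.* + n) ℤ.+ + χ ℤ.* + k) ℤ.- + χ ℤ.* (+ k ℤ.* + k)
    ≤⟨ ℤₚ.+-monoˡ-≤ (ℤ.- (+ χ ℤ.* (+ k ℤ.* + k))) cast ⟩
  (+ 2 ℤ.* + S ℤ.+ + χ ℤ.* (+ k ℤ.* + k)) ℤ.- + χ ℤ.* (+ k ℤ.* + k)
    ≡⟨ rhs (+ S) (+ χ) (+ k) ⟩
  + S ℤ.* + 2 ∎)
  where
  open ℤₚ.≤-Reasoning
  S = layerSum n χ k

  kχ[k-1]≤kχC : (+ k ℤ.* + χ) ℤ.* ℤ.pred (+ k) ℤ.≤ (+ k ℤ.* + χ) ℤ.* C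
  kχ[k-1]≤kχC rewrite sym (ℤₚ.pos-* k χ) = ℤₚ.*-monoˡ-≤-nonNeg (+ (k * χ)) K-1≤C

  cast : + 2 ℤ.* (+ k ℤ.* + n) ℤ.+ + χ ℤ.* + k ℤ.≤ + 2 ℤ.* + S ℤ.+ + χ ℤ.* (+ k ℤ.* + k)
  cast rewrite sym (ℤₚ.pos-* k n) | sym (ℤₚ.pos-* k k) | sym (ℤₚ.pos-* χ k)
             | sym (ℤₚ.pos-* χ (k * k)) | sym (ℤₚ.pos-* 2 (k * n)) | sym (ℤₚ.pos-* 2 S) =
    +≤+ (layerSum≥ n χ k)

  lhs : ∀ n χ k C → k ℤ.* (n ℤ.* + 2 ℤ.+ (ℤ.- (χ ℤ.* C)) ℤ.* 1ℤ) ℤ.* 1ℤ ≡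
                    + 2 ℤ.* (k ℤ.* n) ℤ.- (k ℤ.* χ) ℤ.* C
  lhs = ℤ-Solver.solve-∀
  middle : ∀ n χ k → + 2 ℤ.* (k ℤ.* n) ℤ.- (k ℤ.* χ) ℤ.* (ℤ.-1ℤ ℤ.+ k) ≡
                     (+ 2 ℤ.* (k ℤ.* n) ℤ.+ χ ℤ.* k) ℤ.- χ ℤ.* (k ℤ.* k)
  middle = ℤ-Solver.solve-∀
  rhs : ∀ s χ k → (+ 2 ℤ.* s ℤ.+ χ ℤ.* (k ℤ.* k)) ℤ.- χ ℤ.* (k ℤ.* k) ≡ s ℤ.* + 2
  rhs = ℤ-Solver.solve-∀

lowerBound≤layerSum : ∀ n χ .{{_ : NonZero χ}} → ∃[ k ] lowerBound n χ ≤ + layerSum n χ k / 1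
lowerBound≤layerSum n (suc χ) =
  layerSum≥-ℚ n (suc χ) (0≤ceiling n χ) (pred-ceiling≤ceiling-pred (+ n) χ)

theorem1p1 : ∀ (n : ℕ) (H : Graph n) (1≤n : 1 ≤ℕ n) (χ : ℕ) (isχ : IsChromaticNumber H χ) →
    ∃[ ρ ] (Isρ H ρ
    × lowerBound n χ {{χ-nonZero H 1≤n isχ}} ≤ + ρ / 1
    × ρ ≤ℕ n + length (nonEdges H))
theorem1p1 n H 1≤n χ isχ =
  -- The blow-up serves twice: it makes the search for ρ terminate, and by minimality of ρ it gives
  -- the upper bound.
  let upper     = forcing-n+nonEdges H
      ρ , isρ@((G , forces) , minimal) = least (existsForcing? H) upper
      k , lower = lowerBound≤layerSum n χ {{χ-nonZero H 1≤n isχ}}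
      S≤ρ       = layerSum≤ {H = H} {G = G} (proj₁ isχ) forces k
  in  ρ , isρ
    , ℚᵘₚ.≤-trans lower (*≤* (ℤₚ.*-monoʳ-≤-nonNeg (+ 1) (+≤+ S≤ρ)))
    , minimal _ upper
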